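{- Let $1\le i<j<k$ be integers and let $$\sigma=\sigma_1\text{ - }\sigma_2\cdots\sigma_{k+1}$$ be a vincular pattern with $\sigma_1\cdots\sigma_{k+1}$ a permutation of $\{1,\dots,k+1\}$. Let $\tau=\tau_1\text{ - }\tau_2\cdots\tau_{k+1}$ where $\tau_{i+2},\dots,\tau_{j+1}$ is a permutation of $\sigma_{i+2},\dots,\sigma_{j+1}$ and $\tau_x=\sigma_x$ for $x\in[1,i+1]\cup[j+2,k+1]$. Suppose that for every integer $z$ with $\min(i,k-j)<z<k$ all of the following hold: $$\sigma_2\cdots\sigma_{z+1}\not\sim\sigma_{k-z+2}\cdots\sigma_{k+1},\qquad \sigma_2\cdots\sigma_{z+1}\not\sim\tau_{k-z+2}\cdots\tau_{k+1},$$ $$\tau_2\cdots\tau_{z+1}\not\sim\sigma_{k-z+2}\cdots\sigma_{k+1},\qquad \tau_2\cdots\tau_{z+1}\not\sim\tau_{k-z+2}\cdots\tau_{k+1}.$$ Then $\sigma$ and $\tau$ are filling-shape-Wilf-equivalent: $\sigma\equiv_{\mathrm{fs}}\tau$.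
   Context: Two sequences of positive integers of the same length are order-isomorphic, $a_1\cdots a_k\sim b_1\cdots b_k$, if for all $p,q$ one has $a_p<a_q$ iff $b_p<b_q$. A vincular pattern of length $\ell$ is a pair $(\sigma,T)$ with $\sigma$ a permutation of $\{1,\dots,\ell\}$ and $T\subseteq\{1,\dots,\ell-1\}$. It is written as the word $\sigma_1\cdots\sigma_\ell$ with a dash between $\sigma_p$ and $\sigma_{p+1}$ exactly when $p\notin T$. Thus $\sigma_1\text{ - }\sigma_2\cdots\sigma_{k+1}$ has $T=\{2,\dots,k\}$. Young diagrams are drawn in French notation: a Young diagram $D$ with $n$ columns and $m$ rows is a set of cells (column, row) in $\{1,\dots,n\}\times\{1,\dots,m\}$ such that if $(a,b)\in D$ then $(a',b')\in D$ for all $1\le a'\le a$, $1\le b'\le b$; the cell $(1,1)$ is at the bottom left. A filling of $D$ is a set of selected cells of $D$ with no two in the same column and no two in the same row. For a column $c$ containing a selected cell, let $\pi(c)$ be the row of that cell. A filling contains the vincular pattern $(\sigma,T)$ of length $\ell$ if there are columns $i_1<\cdots<i_\ell$ such that: $(i_1,\pi(i_1)),\dots,(i_\ell,\pi(i_\ell))$ are selected cells; $\pi(i_1)\cdots\pi(i_\ell)\sim\sigma_1\cdots\sigma_\ell$; $(i_p,\pi(i_q))\in D$ for all $1\le p,q\le \ell$; and $i_{p+1}-i_p=1$ for all $p\in T$. Otherwise it avoids the pattern. Two vincular patterns $\sigma,\tau$ are filling-shape-Wilf-equivalent, $\sigma\equiv_{\mathrm{fs}}\tau$, if for every Young diagram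 $D$, every set $R$ of rows and every set $C$ of columns, the number of fillings of $D$ avoiding $\sigma$ whose set of rows without a selected cell is exactly $R$ and whose set of columns without a selected cell is exactly $C$ equals the number of such fillings avoiding $\tau$. -}

module Defs where

open import Data.Fin.Base using (Fin; zero; suc; toℕ; inject₁; inject≤; _↑ʳ_)
import Data.Fin.Base as Fin
import Data.Fin.Properties as Fin
open import Data.Fin.Permutation using (Permutation′; _⟨$⟩ʳ_)
open import Data.Fin.Subset using (Subset; _∈_; ⊤; inside; outside)
open import Data.Fin.Subset.Properties using (_∈?_)
open import Data.List.Base using (List; []; _∷_; length; filter; cartesianProductWith)
open import Data.Nat.Base using (ℕ; zero; suc; _+_; _∸_; _≤_; _<_; s≤s)
open import Data.Nat.Properties using (_≟_; _<?_; <⇒≤; ≤-trans; ≤-reflexive; m+[n∸m]≡n; m∸n+n≡m)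
open import Data.Product.Base using (∃; _×_; _,_)
open import Data.Vec.Base using (Vec; []; _∷_; lookup)
open import Data.Vec.Functional using (Vector)
open import Function.Base using (_∘_)
open import Function.Bundles using (_⇔_; mk⇔; Equivalence)
open import Level using (0ℓ)
open import Relation.Binary.PropositionalEquality.Core using (_≡_)
open import Relation.Nullary.Decidable using (Dec; map′; ¬?; _×-dec_; _→-dec_)
open import Relation.Nullary.Negation using (¬_)
open import Relation.Unary using (Pred; Decidable)

------------------------------------------------------------------------
-- Words

infix 4 _∼_

_∼_ : ∀ {n} → Vector ℕ n → Vector ℕ n → Set
a ∼ b = ∀ p q → (a p < a q) ⇔ (b p < b q)

-- One-line notation with letters 1, …, n; positions are elements of Fin n,
-- so the p-th letter in 1-based counting sits at the position with toℕ = p ∸ 1.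
word : ∀ {n} → Permutation′ n → Vector ℕ n
word σ p = suc (toℕ (σ ⟨$⟩ʳ p))

-- factor w s l _  is the contiguous factor  w_{s+1} ⋯ w_{s+l}  (1-based).
factor : ∀ {n} → Vector ℕ n → (s l : ℕ) → .(s + l ≤ n) → Vector ℕ l
factor w s l s+l≤n p = w (inject≤ (s ↑ʳ p) s+l≤n)

-- w_2 ⋯ w_{z+1}
initialFactor : ∀ {k z} → .(z < k) → Vector ℕ (suc k) → Vector ℕ z
initialFactor {z = z} z<k w = factor w 1 z (s≤s (<⇒≤ z<k))

-- w_{k-z+2} ⋯ w_{k+1}
finalFactor : ∀ {k z} → .(z < k) → Vector ℕ (suc k) → Vector ℕ z
finalFactor {k} {z} z<k w =
  factor w (suc (k ∸ z)) z (s≤s (≤-reflexive (m∸n+n≡m (<⇒≤ z<k))))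

-- w_{i+2} ⋯ w_{j+1}
middleFactor : ∀ {i j k} → .(i < j) → .(j < k) → Vector ℕ (suc k) → Vector ℕ (j ∸ i)
middleFactor {i} {j} i<j j<k w =
  factor w (suc i) (j ∸ i)
    (s≤s (≤-trans (≤-reflexive (m+[n∸m]≡n (<⇒≤ i<j))) (<⇒≤ j<k)))

------------------------------------------------------------------------
-- Vincular patterns

-- VincularPattern ℓ consists of the patterns of length suc ℓ.  The element
-- p : Fin ℓ stands for the gap between the positions inject₁ p and suc p.
record VincularPattern (ℓ : ℕ) : Set where
  constructor vincular
  field
    perm     : Permutation′ (suc ℓ)
    adjacent : Subset ℓ

-- σ₁-σ₂⋯σ_{k+1}
dashedAfterFirst : ∀ {k} → Permutation′ (suc k) → VincularPattern k
dashedAfterFirst {zero}  σ = vincular σ []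
dashedAfterFirst {suc _} σ = vincular σ (outside ∷ ⊤)

------------------------------------------------------------------------
-- Young diagrams and fillings

-- Sets of cells in n columns and m rows: one set of rows for each column.
Cells : ℕ → ℕ → Set
Cells n m = Vec (Subset m) n

infix 4 ⟨_,_⟩∈_ ⟨_,_⟩∈?_

⟨_,_⟩∈_ : ∀ {n m} → Fin n → Fin m → Cells n m → Set
⟨ c , r ⟩∈ F = r ∈ lookup F c

⟨_,_⟩∈?_ : ∀ {n m} (c : Fin n) (r : Fin m) (F : Cells n m) → Dec (⟨ c , r ⟩∈ F)
⟨ c , r ⟩∈? F = r ∈? lookup F c

record YoungDiagram (n m : ℕ) : Set where
  field
    cells      : Cells n m
    downClosed : ∀ {a a′ b b′} → a′ Fin.≤ a → b′ Fin.≤ b →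
                 ⟨ a , b ⟩∈ cells → ⟨ a′ , b′ ⟩∈ cells

open YoungDiagram public

record IsFilling {n m} (D : YoungDiagram n m) (F : Cells n m) : Set where
  field
    inDiagram    : ∀ c r → ⟨ c , r ⟩∈ F → ⟨ c , r ⟩∈ cells D
    columnUnique : ∀ c r r′ → ⟨ c , r ⟩∈ F → ⟨ c , r′ ⟩∈ F → r ≡ r′
    rowUnique    : ∀ c c′ r → ⟨ c , r ⟩∈ F → ⟨ c′ , r ⟩∈ F → c ≡ c′

-- An occurrence in the columns i₁ < ⋯ < i_{ℓ+1}; the row ρ_p is π(i_p).
record IsOccurrence {n m ℓ} (D : YoungDiagram n m) (F : Cells n m)
                    (P : VincularPattern ℓ)
                    (i : Vec (Fin n) (suc ℓ)) (ρ : Vec (Fin m) (suc ℓ)) : Set where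
  open VincularPattern P
  field
    increasing   : ∀ p q → p Fin.< q → lookup i p Fin.< lookup i q
    selected     : ∀ p → ⟨ lookup i p , lookup ρ p ⟩∈ F
    orderIso     : (toℕ ∘ lookup ρ) ∼ word perm
    boxInDiagram : ∀ p q → ⟨ lookup i p , lookup ρ q ⟩∈ cells D
    consecutive  : ∀ p → p ∈ adjacent →
                   toℕ (lookup i (suc p)) ≡ suc (toℕ (lookup i (inject₁ p)))

Contains : ∀ {n m ℓ} → YoungDiagram n m → Cells n m → VincularPattern ℓ → Set
Contains D F P = ∃ λ i → ∃ λ ρ → IsOccurrence D F P i ρ

Avoids : ∀ {n m ℓ} → YoungDiagram n m → Cells n m → VincularPattern ℓ → Set
Avoids D F P = ¬ Contains D F P

EmptyRows : ∀ {n m} → Cells n m → Subset m → Set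
EmptyRows F R = ∀ r → (r ∈ R) ⇔ (∀ c → ¬ ⟨ c , r ⟩∈ F)

EmptyColumns : ∀ {n m} → Cells n m → Subset n → Set
EmptyColumns F C = ∀ c → (c ∈ C) ⇔ (∀ r → ¬ ⟨ c , r ⟩∈ F)

AvoidingFilling : ∀ {n m ℓ} → YoungDiagram n m → Subset m → Subset n →
                  VincularPattern ℓ → Pred (Cells n m) 0ℓ
AvoidingFilling D R C P F =
  IsFilling D F × Avoids D F P × EmptyRows F R × EmptyColumns F C

------------------------------------------------------------------------
-- Decidability

infix 3 _⇔?_

_⇔?_ : ∀ {A B : Set} → Dec A → Dec B → Dec (A ⇔ B)
a? ⇔? b? = map′ (λ (f , g) → mk⇔ f g) (λ e → Equivalence.to e , Equivalence.from e)
  ((a? →-dec b?) ×-dec (b? →-dec a?))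

anyVec? : ∀ {n} l {P : Pred (Vec (Fin n) l) 0ℓ} → Decidable P → Dec (∃ P)
anyVec? zero    P? = map′ ([] ,_) (λ { ([] , p) → p }) (P? [])
anyVec? (suc l) P? = map′ (λ (x , xs , p) → x ∷ xs , p) (λ { (x ∷ xs , p) → x , xs , p })
  (Fin.any? λ x → anyVec? l λ xs → P? (x ∷ xs))

_∼?_ : ∀ {n} (a b : Vector ℕ n) → Dec (a ∼ b)
a ∼? b = Fin.all? λ p → Fin.all? λ q → (a p <? a q) ⇔? (b p <? b q)

isFilling? : ∀ {n m} (D : YoungDiagram n m) → Decidable (IsFilling D)
isFilling? D F = map′
  (λ (x , y , z) → record { inDiagram = x ; columnUnique = y ; rowUnique = z })
  (λ f → let open IsFilling f in inDiagram , columnUnique , rowUnique)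
  ((Fin.all? λ c → Fin.all? λ r → (⟨ c , r ⟩∈? F) →-dec (⟨ c , r ⟩∈? cells D))
   ×-dec
   (Fin.all? λ c → Fin.all? λ r → Fin.all? λ r′ →
     (⟨ c , r ⟩∈? F) →-dec ((⟨ c , r′ ⟩∈? F) →-dec (r Fin.≟ r′)))
   ×-dec
   (Fin.all? λ c → Fin.all? λ c′ → Fin.all? λ r →
     (⟨ c , r ⟩∈? F) →-dec ((⟨ c′ , r ⟩∈? F) →-dec (c Fin.≟ c′))))

isOccurrence? : ∀ {n m ℓ} (D : YoungDiagram n m) F (P : VincularPattern ℓ) i ρ →
                Dec (IsOccurrence D F P i ρ)
isOccurrence? D F P i ρ = map′
  (λ (a , b , c , d , e) → record
    { increasing = a ; selected = b ; orderIso = c ; boxInDiagram = d ; consecutive = e })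
  (λ o → let open IsOccurrence o in
    increasing , selected , orderIso , boxInDiagram , consecutive)
  ((Fin.all? λ p → Fin.all? λ q → (p Fin.<? q) →-dec (lookup i p Fin.<? lookup i q))
   ×-dec
   (Fin.all? λ p → ⟨ lookup i p , lookup ρ p ⟩∈? F)
   ×-dec
   ((toℕ ∘ lookup ρ) ∼? word perm)
   ×-dec
   (Fin.all? λ p → Fin.all? λ q → ⟨ lookup i p , lookup ρ q ⟩∈? cells D)
   ×-dec
   (Fin.all? λ p → (p ∈? adjacent) →-dec
     (toℕ (lookup i (suc p)) ≟ suc (toℕ (lookup i (inject₁ p))))))
  where open VincularPattern P

contains? : ∀ {n m ℓ} (D : YoungDiagram n m) F (P : VincularPattern ℓ) →
            Dec (Contains D F P)
contains? D F P = anyVec? _ λ i → anyVec? _ λ ρ → isOccurrence? D F P i ρ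

avoidingFilling? : ∀ {n m ℓ} (D : YoungDiagram n m) R C (P : VincularPattern ℓ) →
                   Decidable (AvoidingFilling D R C P)
avoidingFilling? D R C P F =
  isFilling? D F
  ×-dec ¬? (contains? D F P)
  ×-dec (Fin.all? λ r → (r ∈? R) ⇔? (Fin.all? λ c → ¬? (⟨ c , r ⟩∈? F)))
  ×-dec (Fin.all? λ c → (c ∈? C) ⇔? (Fin.all? λ r → ¬? (⟨ c , r ⟩∈? F)))

------------------------------------------------------------------------
-- Counting

allVecs : ∀ {A : Set} → List A → ∀ n → List (Vec A n)
allVecs xs zero    = [] ∷ []
allVecs xs (suc n) = cartesianProductWith _∷_ xs (allVecs xs n)

-- Every set of cells occurs exactly once in this list.
allCells : ∀ n m → List (Cells n m)
allCells n m = allVecs (allVecs (inside ∷ outside ∷ []) m) n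

#avoidingFillings : ∀ {n m ℓ} → YoungDiagram n m → Subset m → Subset n →
                    VincularPattern ℓ → ℕ
#avoidingFillings {n} {m} D R C P =
  length (filter (avoidingFilling? D R C P) (allCells n m))

infix 4 _≡fs_

_≡fs_ : ∀ {ℓ ℓ′} → VincularPattern ℓ → VincularPattern ℓ′ → Set
P ≡fs Q = ∀ {n m} (D : YoungDiagram n m) (R : Subset m) (C : Subset n) →
  #avoidingFillings D R C P ≡ #avoidingFillings D R C Q

{-# OPTIONS --safe #-}
module Submission where

-- By the overlap hypothesis, two blocks of columns carrying σ₂⋯σ_{k+1} or τ₂⋯τ_{k+1} share so few columns
-- that neither meets the middle of the other, where σ and τ differ.  Hence rearranging the middle of one
-- block turns an occurrence of τ starting there into one of σ and creates or destroys no occurrence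
-- starting elsewhere: the first letter of another occurrence may move, but only among columns before
-- its block, and the box condition survives because Young diagrams are down-closed.  Now change the
-- forbidden pattern from σ to τ one starting column t at a time.  The fillings that avoid τ at the
-- starting columns before t and σ at all others are as many for t as for t + 1.

open import Defs
open import Data.Bool.Base using (Bool; true; false; not)
open import Data.Bool.Properties using (not-involutive; T-≡)
open import Data.Fin.Base using (Fin; zero; suc; toℕ; inject₁; inject≤; _↑ʳ_; punchIn)
import Data.Fin.Base as Fin
import Data.Fin.Properties as Fin
open import Data.Fin.Permutation using
  (Permutation′; _⟨$⟩ʳ_; _⟨$⟩ˡ_; inverseˡ; inverseʳ; remove; lift₀; lift₀-remove; punchIn-permute; flip; _∘ₚ_)
open import Data.Fin.Subset using (Subset; _∈_; outside; inside)
open import Data.Fin.Subset.Properties using (_∈?_; ∈⊤)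
open import Data.List.Base using (List; []; _∷_; length; filter)
open import Data.List.Membership.Propositional using () renaming (_∈_ to _∈ₗ_)
open import Data.List.Membership.Propositional.Properties
  using (∈-filter⁺; ∈-filter⁻; ∈-cartesianProductWith⁺)
open import Data.List.Properties using (length-removeAt′; filter-≐)
open import Data.List.Relation.Unary.All as All using ([]; _∷_)
open import Data.List.Relation.Unary.Any as Any using (here; there; index)
open import Data.List.Relation.Unary.Unique.Propositional using (Unique; []; _∷_)
import Data.List.Relation.Unary.Unique.Propositional.Properties as Unique
open import Data.Nat.Base using (ℕ; zero; suc; _+_; _∸_; _⊓_; _≤_; _<_; _<ᵇ_; z≤n; s≤s; s≤s⁻¹)
open import Data.Nat.Properties
open import Data.Product.Base using (∃; _×_; _,_)
open import Data.Sum.Base as Sum using (_⊎_; inj₁; inj₂)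
open import Data.Vec.Base using (Vec; []; _∷_; lookup; tabulate; tail; here; there)
open import Data.Vec.Functional.Relation.Binary.Permutation using (_↭_)
open import Data.Vec.Properties using (lookup∘tabulate; tabulate∘lookup; tabulate-cong; ∷-injective)
open import Function.Base using (_∘_; id)
open import Function.Bundles using (_⇔_; mk⇔; Equivalence)
open import Function.Properties.Equivalence using () renaming (trans to ⇔-trans; sym to ⇔-sym)
open import Relation.Binary.Definitions using (tri<; tri≈; tri>)
open import Relation.Binary.PropositionalEquality
open import Relation.Nullary.Decidable using (Dec; yes; no; ¬?; _×-dec_)
open import Relation.Nullary.Negation using (¬_; contradiction)
open import Relation.Unary using (Pred; Decidable)

private
  variable
    A B : Set
    a b k n m : ℕ

-- Counting by injective relations

∈-─⁺ : {x y : A} {xs : List A} (x∈xs : x ∈ₗ xs) → y ∈ₗ xs → y ≢ x → y ∈ₗ (xs Any.─ x∈xs)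
∈-─⁺ (here refl) (here refl) y≢x = contradiction refl y≢x
∈-─⁺ (here _)    (there y∈)  y≢x = y∈
∈-─⁺ (there x∈)  (here eq)   y≢x = here eq
∈-─⁺ (there x∈)  (there y∈)  y≢x = there (∈-─⁺ x∈ y∈ y≢x)

-- Induction on `xs`: a partner of the head is deleted from `ys`, and injectivity of `R` keeps it
-- from being the partner of a later element. A relation suits partners that depend on a chosen
-- occurrence.
length-mono-injective : (R : A → B → Set) → (∀ {x x′ y} → R x y → R x′ y → x ≡ x′) →
  ∀ {xs ys} → Unique xs → (∀ {x} → x ∈ₗ xs → ∃ λ y → y ∈ₗ ys × R x y) →
  length xs ≤ length ys
length-mono-injective R R-inj {[]} _ _ = z≤n
length-mono-injective R R-inj {x ∷ xs} {ys} (x∉xs ∷ xs!) total with total (here refl)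
... | y , y∈ys , Rxy = ≤-trans
  (s≤s (length-mono-injective R R-inj xs! λ {x′} x′∈xs →
    let y′ , y′∈ys , Rx′y′ = total (there x′∈xs) in
    y′ , ∈-─⁺ y∈ys y′∈ys
           (λ { refl → All.lookup x∉xs x′∈xs (R-inj Rxy Rx′y′) }) , Rx′y′))
  (≤-reflexive (sym (length-removeAt′ ys (index y∈ys))))

allVecs-complete : {xs : List A} → (∀ x → x ∈ₗ xs) → ∀ {n} (v : Vec A n) → v ∈ₗ allVecs xs n
allVecs-complete ∈xs []      = here refl
allVecs-complete ∈xs (x ∷ v) = ∈-cartesianProductWith⁺ _∷_ (∈xs x) (allVecs-complete ∈xs v)

allVecs-unique : {xs : List A} → Unique xs → ∀ n → Unique (allVecs xs n)
allVecs-unique xs! zero    = [] ∷ []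
allVecs-unique xs! (suc n) =
  Unique.cartesianProductWith⁺ _∷_ ∷-injective xs! (allVecs-unique xs! n)

allCells-complete : (F : Cells n m) → F ∈ₗ allCells n m
allCells-complete = allVecs-complete (allVecs-complete
  λ { inside → here refl ; outside → there (here refl) })

allCells-unique : ∀ n m → Unique (allCells n m)
allCells-unique n m = allVecs-unique (allVecs-unique (((λ ()) ∷ []) ∷ [] ∷ []) m) n

-- Permuting the points of an embedded finite set

extend : (Fin a → Fin b) → (Fin a → Fin a) → Fin b → Fin b
extend e f c with Fin.any? (λ p → e p Fin.≟ c)
... | yes (p , _) = e (f p)
... | no  _       = c

module _ {e : Fin a → Fin b} where

  extend-image : (∀ {p q} → e p ≡ e q → p ≡ q) → ∀ f p → extend e f (e p) ≡ e (f p)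
  extend-image e-inj f p with Fin.any? (λ q → e q Fin.≟ e p)
  ... | yes (q , eq) = cong (e ∘ f) (e-inj eq)
  ... | no  ¬∃       = contradiction (p , refl) ¬∃

  extend-fixed : ∀ f {c} → (∀ p → e p ≢ c) → extend e f c ≡ c
  extend-fixed f {c} c∉e with Fin.any? (λ q → e q Fin.≟ c)
  ... | yes (q , eq) = contradiction eq (c∉e q)
  ... | no  _        = refl

  image? : ∀ c → (∃ λ p → e p ≡ c) ⊎ (∀ p → e p ≢ c)
  image? c with Fin.any? (λ q → e q Fin.≟ c)
  ... | yes q  = inj₁ q
  ... | no  ¬∃ = inj₂ λ p eq → ¬∃ (p , eq)

  extend-inverse : (∀ {p q} → e p ≡ e q → p ≡ q) → ∀ {f g} → (∀ p → g (f p) ≡ p) →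
                   ∀ c → extend e g (extend e f c) ≡ c
  extend-inverse e-inj {f} {g} gf c with image? c
  ... | inj₁ (p , refl) = begin
    extend e g (extend e f (e p)) ≡⟨ cong (extend e g) (extend-image e-inj f p) ⟩
    extend e g (e (f p))          ≡⟨ extend-image e-inj g (f p) ⟩
    e (g (f p))                   ≡⟨ cong e (gf p) ⟩
    e p                           ∎
    where open ≡-Reasoning
  ... | inj₂ c∉e = trans (cong (extend e g) (extend-fixed f c∉e)) (extend-fixed g c∉e)

-- Used to see that occurrences with the same block columns induce the same rearrangement, wherever
-- their first letters lie.
extend-cong : {e e′ : Fin a → Fin b} → (∀ {p q} → e p ≡ e q → p ≡ q) →
              (∀ p → e p ≡ e′ p) → ∀ f c → extend e f c ≡ extend e′ f c
extend-cong {e = e} {e′} e-inj e≗e′ f c with image? {e = e} c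
... | inj₁ (p , refl) = begin
  extend e f (e p)   ≡⟨ extend-image e-inj f p ⟩
  e (f p)            ≡⟨ e≗e′ (f p) ⟩
  e′ (f p)           ≡⟨ extend-image (λ eq → e-inj (trans (e≗e′ _) (trans eq (sym (e≗e′ _))))) f p ⟨
  extend e′ f (e′ p) ≡⟨ cong (extend e′ f) (e≗e′ p) ⟨
  extend e′ f (e p)  ∎
  where open ≡-Reasoning
... | inj₂ c∉e =
  trans (extend-fixed f c∉e) (sym (extend-fixed f λ p → c∉e p ∘ trans (e≗e′ p)))

-- Rigidity of order isomorphisms between permutations

-- Induction on the value of `x`: its predecessor is at most its own image, which lies strictly
-- below the image of `x`.
strictMono⇒inflationary : (f : Fin n → Fin n) → (∀ {x y} → x Fin.< y → f x Fin.< f y) →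
                          ∀ x → x Fin.≤ f x
strictMono⇒inflationary f f-mono x = go (toℕ x) x refl
  where
  go : ∀ d x → toℕ x ≡ d → d ≤ toℕ (f x)
  go zero    x       _  = z≤n
  go (suc d) (suc x) eq = ≤-<-trans
    (go d (inject₁ x) (trans (Fin.toℕ-inject₁ x) (suc-injective eq)))
    (f-mono (≤-reflexive (cong suc (Fin.toℕ-inject₁ x))))

-- The map sending each letter of `π` to the letter of `π′` in the same position is strictly
-- increasing, hence inflationary.
mono⇒≤ : (π π′ : Permutation′ n) →
  (∀ {p q} → π ⟨$⟩ʳ p Fin.< π ⟨$⟩ʳ q → π′ ⟨$⟩ʳ p Fin.< π′ ⟨$⟩ʳ q) →
  ∀ p → π ⟨$⟩ʳ p Fin.≤ π′ ⟨$⟩ʳ p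
mono⇒≤ π π′ mono p = subst (λ q → π ⟨$⟩ʳ p Fin.≤ π′ ⟨$⟩ʳ q) (inverseˡ π)
  (strictMono⇒inflationary (λ x → π′ ⟨$⟩ʳ (π ⟨$⟩ˡ x))
    (λ x<y → mono (subst₂ Fin._<_ (sym (inverseʳ π)) (sym (inverseʳ π)) x<y))
    (π ⟨$⟩ʳ p))

punchIn-mono-< : ∀ x {p q : Fin n} → p Fin.< q → punchIn x p Fin.< punchIn x q
punchIn-mono-< x p<q = ≰⇒> λ ≤ → <⇒≱ p<q (Fin.punchIn-cancel-≤ x _ _ ≤)

punchIn-cancel-< : ∀ x {p q : Fin n} → punchIn x p Fin.< punchIn x q → p Fin.< q
punchIn-cancel-< x p<q = ≰⇒> λ ≤ → <⇒≱ p<q (Fin.punchIn-mono-≤ x _ _ ≤)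

remove-zero : (π : Permutation′ (suc n)) → ∀ p →
              π ⟨$⟩ʳ suc p ≡ punchIn (π ⟨$⟩ʳ zero) (remove zero π ⟨$⟩ʳ p)
remove-zero π p = punchIn-permute π zero p

-- With equal first letters, the remaining letters form the same set in both permutations, and a set
-- has only one arrangement of a given relative order. Deleting the first letter reduces this to
-- `mono⇒≤` in both directions.
orderIso⇒≈ : (π π′ : Permutation′ (suc n)) → π ⟨$⟩ʳ zero ≡ π′ ⟨$⟩ʳ zero →
  (∀ p q → (π ⟨$⟩ʳ suc p Fin.< π ⟨$⟩ʳ suc q) ⇔ (π′ ⟨$⟩ʳ suc p Fin.< π′ ⟨$⟩ʳ suc q)) →
  ∀ x → π ⟨$⟩ʳ x ≡ π′ ⟨$⟩ʳ x
orderIso⇒≈ π π′ eq iso zero    = eq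
orderIso⇒≈ π π′ eq iso (suc p) = begin
  π ⟨$⟩ʳ suc p                                   ≡⟨ remove-zero π p ⟩
  punchIn (π ⟨$⟩ʳ zero) (remove zero π ⟨$⟩ʳ p)   ≡⟨ cong₂ punchIn eq removed ⟩
  punchIn (π′ ⟨$⟩ʳ zero) (remove zero π′ ⟨$⟩ʳ p) ≡⟨ remove-zero π′ p ⟨
  π′ ⟨$⟩ʳ suc p                                  ∎
  where
  open ≡-Reasoning
  transfer : (α β : Permutation′ (suc _)) →
    (∀ {p q} → α ⟨$⟩ʳ suc p Fin.< α ⟨$⟩ʳ suc q → β ⟨$⟩ʳ suc p Fin.< β ⟨$⟩ʳ suc q) →
    ∀ p → remove zero α ⟨$⟩ʳ p Fin.≤ remove zero β ⟨$⟩ʳ p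
  transfer α β mono = mono⇒≤ (remove zero α) (remove zero β) λ {p} {q} p<q →
    punchIn-cancel-< (β ⟨$⟩ʳ zero) (subst₂ Fin._<_ (remove-zero β p) (remove-zero β q)
      (mono (subst₂ Fin._<_ (sym (remove-zero α p)) (sym (remove-zero α q))
        (punchIn-mono-< (α ⟨$⟩ʳ zero) p<q))))
  removed : remove zero π ⟨$⟩ʳ p ≡ remove zero π′ ⟨$⟩ʳ p
  removed = Fin.toℕ-injective (≤-antisym
    (transfer π π′ (Equivalence.to (iso _ _)) p)
    (transfer π′ π (Equivalence.from (iso _ _)) p))

-- Occurrences of σ₁-σ₂⋯σ_{k+1}

open IsOccurrence
open IsFilling

consecutive⇒arithmetic : (g : Fin (suc k) → ℕ) → (∀ p → g (suc p) ≡ suc (g (inject₁ p))) →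
                         ∀ p → g p ≡ g zero + toℕ p
consecutive⇒arithmetic g step zero = sym (+-identityʳ _)
consecutive⇒arithmetic {suc k} g step (suc p) = begin
  g (suc p)                ≡⟨ consecutive⇒arithmetic (g ∘ suc) (step ∘ suc) p ⟩
  g (suc zero) + toℕ p     ≡⟨ cong (_+ toℕ p) (step zero) ⟩
  suc (g zero) + toℕ p     ≡⟨ +-suc (g zero) (toℕ p) ⟨
  g zero + suc (toℕ p)     ∎
  where open ≡-Reasoning

lookup-tail : (v : Vec A (suc k)) → ∀ p → lookup (tail v) p ≡ lookup v (suc p)
lookup-tail (_ ∷ _) p = refl

-- The dash frees the first letter, so the block of adjacent columns begins with the second.
-- Patterns here have `suc (suc k)` letters, so `suc k` is the k of the theorem.
startColumn : Vec (Fin n) (suc (suc k)) → ℕ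
startColumn i = toℕ (lookup i (suc zero))

word-< : (π : Permutation′ n) → ∀ p q → (word π p < word π q) ⇔ (π ⟨$⟩ʳ p Fin.< π ⟨$⟩ʳ q)
word-< π p q = mk⇔ s≤s⁻¹ s≤s

∼-trans : {u v w : Fin n → ℕ} → u ∼ v → v ∼ w → u ∼ w
∼-trans u∼v v∼w p q = ⇔-trans (u∼v p q) (v∼w p q)

∼-sym : {u v : Fin n → ℕ} → u ∼ v → v ∼ u
∼-sym u∼v p q = ⇔-sym (u∼v p q)

≗⇒∼ : {u v : Fin n → ℕ} → (∀ p → u p ≡ v p) → u ∼ v
≗⇒∼ eq p q = mk⇔ (subst₂ _<_ (eq p) (eq q)) (subst₂ _<_ (sym (eq p)) (sym (eq q)))

module _ {D : YoungDiagram n m} where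

  Occurs : Cells n m → Permutation′ (suc (suc k)) → ℕ → Set
  Occurs F π t = ∃ λ i → ∃ λ ρ → IsOccurrence D F (dashedAfterFirst π) i ρ × startColumn i ≡ t

  module _ {F : Cells n m} {π : Permutation′ (suc (suc k))} {i ρ}
           (o : IsOccurrence D F (dashedAfterFirst π) i ρ) where

    block-column : ∀ p → toℕ (lookup i (suc p)) ≡ startColumn i + toℕ p
    block-column = consecutive⇒arithmetic (toℕ ∘ lookup i ∘ suc)
      λ p → consecutive o (suc p) (there ∈⊤)

    block-injective : ∀ {p q} → lookup i (suc p) ≡ lookup i (suc q) → p ≡ q
    block-injective {p} {q} eq = Fin.toℕ-injective (+-cancelˡ-≡ (startColumn i) _ _
      (trans (sym (block-column p)) (trans (cong toℕ eq) (block-column q))))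

    first<start : toℕ (lookup i zero) < startColumn i
    first<start = increasing o zero (suc zero) (s≤s z≤n)

    -- Common form of all changes of an occurrence: the first letter goes to a column `c` before the
    -- block, `ψ` tells which old position supplies each letter, and `G` replaces `F`.
    transport : ∀ {G} {π′ : Permutation′ (suc (suc k))} (ψ : Fin (suc (suc k)) → Fin (suc (suc k))) c →
      toℕ c < startColumn i →
      (∀ p → π ⟨$⟩ʳ ψ p ≡ π′ ⟨$⟩ʳ p) →
      (∀ p r → ⟨ lookup i (ψ p) , r ⟩∈ F → ⟨ lookup (c ∷ tail i) p , r ⟩∈ G) →
      IsOccurrence D G (dashedAfterFirst π′) (c ∷ tail i) (tabulate (lookup ρ ∘ ψ))
    transport {G} {π′} ψ c c<start π∘ψ≗π′ F⇒G = go i refl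
      where
      go : ∀ i′ → i′ ≡ i → IsOccurrence D G (dashedAfterFirst π′) (c ∷ tail i) (tabulate (lookup ρ ∘ ψ))
      go (c₀ ∷ cs) refl = record
        { increasing = incr
        ; selected = λ p → subst (λ r → ⟨ lookup (c ∷ cs) p , r ⟩∈ G) (sym (lookup∘tabulate (lookup ρ ∘ ψ) p))
            (F⇒G p _ (selected o (ψ p)))
        ; orderIso = ∼-trans (≗⇒∼ λ p → cong toℕ (lookup∘tabulate (lookup ρ ∘ ψ) p))
            (∼-trans (λ p q → orderIso o (ψ p) (ψ q)) (≗⇒∼ λ p → cong (suc ∘ toℕ) (π∘ψ≗π′ p)))
        ; boxInDiagram = λ p q → subst (λ r → ⟨ lookup (c ∷ cs) p , r ⟩∈ cells D)
            (sym (lookup∘tabulate (lookup ρ ∘ ψ) q)) (box p q)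
        ; consecutive = λ { (suc p) → consecutive o (suc p) }
        }
        where
        incr : ∀ p q → p Fin.< q → lookup (c ∷ cs) p Fin.< lookup (c ∷ cs) q
        incr zero (suc zero) _ = c<start
        incr zero (suc (suc q)) _ = <-trans c<start (increasing o (suc zero) (suc (suc q)) (s≤s (s≤s z≤n)))
        incr (suc p) (suc q) p<q = increasing o (suc p) (suc q) p<q
        box : ∀ p q → ⟨ lookup (c ∷ cs) p , lookup ρ (ψ q) ⟩∈ cells D
        -- Column `c` lies left of the block's first column, so down-closure supplies its cells of
        -- the box.
        box zero    q = downClosed D (<⇒≤ c<start) ≤-refl (boxInDiagram o (suc zero) (ψ q))
        box (suc p) q = boxInDiagram o (suc p) (ψ q)

    occurs-cong : (π′ : Permutation′ (suc (suc k))) → (∀ x → π ⟨$⟩ʳ x ≡ π′ ⟨$⟩ʳ x) →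
                  Occurs F π′ (startColumn i)
    occurs-cong π′ eq = lookup i zero ∷ tail i , _ ,
      transport {π′ = π′} id (lookup i zero) first<start eq same , cong toℕ (lookup-tail i zero)
      where
      same : ∀ p r → ⟨ lookup i p , r ⟩∈ F → ⟨ lookup (lookup i zero ∷ tail i) p , r ⟩∈ F
      same zero    r = id
      same (suc p) r = subst (λ c → ⟨ c , r ⟩∈ F) (sym (lookup-tail i p))

  module _ {F : Cells n m} (filling : IsFilling D F) {π π′ : Permutation′ (suc (suc k))} {i ρ i′ ρ′}
           (o : IsOccurrence D F (dashedAfterFirst π) i ρ)
           (o′ : IsOccurrence D F (dashedAfterFirst π′) i′ ρ′) where

    same-row : ∀ {p q} → toℕ (lookup i p) ≡ toℕ (lookup i′ q) → lookup ρ p ≡ lookup ρ′ q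
    same-row {p} {q} eq = columnUnique filling _ _ _ (selected o p)
      (subst (λ c → ⟨ c , _ ⟩∈ F) (sym (Fin.toℕ-injective eq)) (selected o′ q))

    -- Blocks on the same columns select the same rows, so the blocks of both patterns have the same
    -- relative order, and rigidity applies.
    same-start⇒≈ : startColumn i ≡ startColumn i′ → π ⟨$⟩ʳ zero ≡ π′ ⟨$⟩ʳ zero →
                    ∀ x → π ⟨$⟩ʳ x ≡ π′ ⟨$⟩ʳ x
    same-start⇒≈ eq π₀≡π′₀ = orderIso⇒≈ π π′ π₀≡π′₀ λ p q →
      ⇔-trans (⇔-sym (⇔-trans (orderIso o (suc p) (suc q)) (word-< π _ _)))
        (⇔-trans (≗⇒∼ rows p q) (⇔-trans (orderIso o′ (suc p) (suc q)) (word-< π′ _ _)))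
      where
      rows : ∀ p → toℕ (lookup ρ (suc p)) ≡ toℕ (lookup ρ′ (suc p))
      rows p = cong toℕ (same-row {suc p} {suc p} (begin
        toℕ (lookup i (suc p))         ≡⟨ block-column o p ⟩
        startColumn i + toℕ p          ≡⟨ cong (_+ toℕ p) eq ⟩
        startColumn i′ + toℕ p         ≡⟨ block-column o′ p ⟨
        toℕ (lookup i′ (suc p))        ∎))
        where open ≡-Reasoning

    -- The last `z` columns of the block of `o` are the first `z` of the block of `o′`; both factors
    -- have the relative order of the rows selected there.
    overlap⇒∼ : ∀ {z} (z<k : z < suc k) → startColumn i′ ≡ startColumn i + (suc k ∸ z) →
                initialFactor z<k (word π′) ∼ finalFactor z<k (word π)
    overlap⇒∼ {z} z<k eq = ∼-trans (∼-sym (λ p q → orderIso o′ (x p) (x q)))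
      (∼-trans (≗⇒∼ λ p → sym (cong toℕ (same-row {y p} {x p} (columns p))))
        (λ p q → orderIso o (y p) (y q)))
      where
      .x≤ : 1 + z ≤ suc (suc k)
      x≤ = s≤s (<⇒≤ z<k)
      .y≤ : suc (suc k ∸ z) + z ≤ suc (suc k)
      y≤ = s≤s (≤-reflexive (m∸n+n≡m (<⇒≤ z<k)))
      x y : Fin z → Fin (suc (suc k))
      x p = inject≤ (1 ↑ʳ p) x≤
      y p = inject≤ (suc (suc k ∸ z) ↑ʳ p) y≤
      columns : ∀ p → toℕ (lookup i (y p)) ≡ toℕ (lookup i′ (x p))
      columns p = begin
        toℕ (lookup i (suc _))                      ≡⟨ block-column o _ ⟩
        startColumn i + toℕ (inject≤ (suc k ∸ z ↑ʳ p) (s≤s⁻¹ y≤))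
                                                    ≡⟨ cong (startColumn i +_) (Fin.toℕ-inject≤ _ _) ⟩
        startColumn i + toℕ (suc k ∸ z ↑ʳ p)        ≡⟨ cong (startColumn i +_) (Fin.toℕ-↑ʳ (suc k ∸ z) p) ⟩
        startColumn i + (suc k ∸ z + toℕ p)         ≡⟨ +-assoc (startColumn i) _ _ ⟨
        startColumn i + (suc k ∸ z) + toℕ p         ≡⟨ cong₂ _+_ eq (Fin.toℕ-inject≤ p _) ⟨
        startColumn i′ + toℕ (inject≤ p (s≤s⁻¹ x≤)) ≡⟨ block-column o′ _ ⟨
        toℕ (lookup i′ (x p))                       ∎
        where open ≡-Reasoning

-- Rearranging a block of columns

-- The position in π of the letter that π′ has at the given position.
realign : (π π′ : Permutation′ (suc k)) → Permutation′ k
realign π π′ = remove zero (π′ ∘ₚ flip π)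

module _ (π π′ : Permutation′ (suc k)) (π₀≡π′₀ : π ⟨$⟩ʳ zero ≡ π′ ⟨$⟩ʳ zero) where

  realign-suc : ∀ p → suc (realign π π′ ⟨$⟩ʳ p) ≡ π ⟨$⟩ˡ (π′ ⟨$⟩ʳ suc p)
  realign-suc p = lift₀-remove (π′ ∘ₚ flip π)
    (trans (cong (π ⟨$⟩ˡ_) (sym π₀≡π′₀)) (inverseˡ π)) (suc p)

  realign-letter : ∀ p → π ⟨$⟩ʳ (lift₀ (realign π π′) ⟨$⟩ʳ p) ≡ π′ ⟨$⟩ʳ p
  realign-letter zero    = π₀≡π′₀
  realign-letter (suc p) = trans (cong (π ⟨$⟩ʳ_) (realign-suc p)) (inverseʳ π)

  realign-fixed : ∀ {p} → π ⟨$⟩ʳ suc p ≡ π′ ⟨$⟩ʳ suc p → realign π π′ ⟨$⟩ʳ p ≡ p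
  realign-fixed {p} eq = Fin.suc-injective (trans (realign-suc p)
    (trans (cong (π ⟨$⟩ˡ_) (sym eq)) (inverseˡ π)))

columnsOf : Vec (Fin n) (suc (suc k)) → Fin (suc k) → Fin n
columnsOf is p = lookup is (suc p)

rearrange : (Fin (suc k) → Fin n) → Permutation′ (suc k) → Cells n m → Cells n m
rearrange e φ F = tabulate (lookup F ∘ extend e (φ ⟨$⟩ʳ_))

module Rearrangement {D : YoungDiagram n m} {F : Cells n m} (filling : IsFilling D F)
  {π : Permutation′ (suc (suc k))} {is ρ}
  (o : IsOccurrence D F (dashedAfterFirst π) is ρ)
  (π′ : Permutation′ (suc (suc k))) (π₀≡π′₀ : π ⟨$⟩ʳ zero ≡ π′ ⟨$⟩ʳ zero) where

  φ : Permutation′ (suc k)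
  φ = realign π π′

  e : Fin (suc k) → Fin n
  e = columnsOf is

  e-injective : ∀ {p q} → e p ≡ e q → p ≡ q
  e-injective = block-injective o

  θ θ⁻¹ : Fin n → Fin n
  θ   = extend e (φ ⟨$⟩ʳ_)
  θ⁻¹ = extend e (φ ⟨$⟩ˡ_)

  θ∘θ⁻¹ : ∀ c → θ (θ⁻¹ c) ≡ c
  θ∘θ⁻¹ = extend-inverse e-injective λ p → inverseʳ φ

  θ⁻¹∘θ : ∀ c → θ⁻¹ (θ c) ≡ c
  θ⁻¹∘θ = extend-inverse e-injective λ p → inverseˡ φ

  θ-injective : ∀ {c c′} → θ c ≡ θ c′ → c ≡ c′
  θ-injective {c} {c′} eq = trans (sym (θ⁻¹∘θ c)) (trans (cong θ⁻¹ eq) (θ⁻¹∘θ c′))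

  G : Cells n m
  G = rearrange e φ F

  to-F : ∀ {c r} → ⟨ c , r ⟩∈ G → ⟨ θ c , r ⟩∈ F
  to-F {c} {r} = subst (r ∈_) (lookup∘tabulate (lookup F ∘ θ) c)

  to-G : ∀ {c r} → ⟨ θ c , r ⟩∈ F → ⟨ c , r ⟩∈ G
  to-G {c} {r} = subst (r ∈_) (sym (lookup∘tabulate (lookup F ∘ θ) c))

  to-G⁻¹ : ∀ {c r} → ⟨ c , r ⟩∈ F → ⟨ θ⁻¹ c , r ⟩∈ G
  to-G⁻¹ {c} {r} = to-G ∘ subst (λ c → ⟨ c , r ⟩∈ F) (sym (θ∘θ⁻¹ c))

  G-filling : IsFilling D G
  G-filling = record
    { inDiagram    = inside-D
    ; columnUnique = λ c r r′ x y → columnUnique filling _ r r′ (to-F x) (to-F y)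
    ; rowUnique    = λ c c′ r x y → θ-injective (rowUnique filling _ _ r (to-F x) (to-F y))
    }
    where
    inside-D : ∀ c r → ⟨ c , r ⟩∈ G → ⟨ c , r ⟩∈ cells D
    inside-D c r c,r∈G with image? {e = e} c
    ... | inj₂ c∉e = inDiagram filling c r (subst (λ c → ⟨ c , r ⟩∈ F) (extend-fixed _ c∉e) (to-F c,r∈G))
    -- A cell moved within the block stays in the box spanned by `o`, which lies in the diagram.
    ... | inj₁ (p , refl) = subst (λ r → ⟨ e p , r ⟩∈ cells D)
      (columnUnique filling _ _ _ (selected o (suc (φ ⟨$⟩ʳ p)))
        (subst (λ c → ⟨ c , r ⟩∈ F) (extend-image e-injective (φ ⟨$⟩ʳ_) p) (to-F c,r∈G)))
      (boxInDiagram o (suc p) (suc (φ ⟨$⟩ʳ p)))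

  G-emptyRows : ∀ {R} → EmptyRows F R → EmptyRows G R
  G-emptyRows empty r = ⇔-trans (empty r) (mk⇔ (λ ¬F c → ¬F (θ c) ∘ to-F) (λ ¬G c → ¬G (θ⁻¹ c) ∘ to-G⁻¹))

  -- Block columns are nonempty before and after, and the other columns keep their contents.
  G-emptyColumns : ∀ {C} → EmptyColumns F C → EmptyColumns G C
  G-emptyColumns empty c = ⇔-trans (empty c) (same c)
    where
    same : ∀ c → (∀ r → ¬ ⟨ c , r ⟩∈ F) ⇔ (∀ r → ¬ ⟨ c , r ⟩∈ G)
    same c with image? {e = e} c
    ... | inj₁ (p , refl) = mk⇔
      (λ ¬F → contradiction (selected o (suc p)) (¬F _))
      (λ ¬G → contradiction
        (to-G (subst (λ c → ⟨ c , lookup ρ (suc (φ ⟨$⟩ʳ p)) ⟩∈ F)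
          (sym (extend-image e-injective (φ ⟨$⟩ʳ_) p)) (selected o (suc (φ ⟨$⟩ʳ p)))))
        (¬G _))
    ... | inj₂ c∉e = mk⇔
      (λ ¬F r → ¬F r ∘ subst (λ c → ⟨ c , r ⟩∈ F) (extend-fixed _ c∉e) ∘ to-F)
      (λ ¬G r → ¬G r ∘ to-G ∘ subst (λ c → ⟨ c , r ⟩∈ F) (sym (extend-fixed _ c∉e)))

  θ-before : ∀ {c} → toℕ c < startColumn is → θ c ≡ c
  θ-before {c} c<start = extend-fixed _ λ p eq → <⇒≱ c<start
    (≤-trans (m≤m+n (startColumn is) (toℕ p)) (≤-reflexive (trans (sym (block-column o p)) (cong toℕ eq))))

  G-occurrence : Occurs {D = D} G π′ (startColumn is)
  G-occurrence = lookup is zero ∷ tail is , _ ,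
    transport o {π′ = π′} (lift₀ φ ⟨$⟩ʳ_) (lookup is zero) (first<start o)
      (realign-letter π π′ π₀≡π′₀) moved ,
    cong toℕ (lookup-tail is zero)
    where
    moved : ∀ p r → ⟨ lookup is (lift₀ φ ⟨$⟩ʳ p) , r ⟩∈ F → ⟨ lookup (lookup is zero ∷ tail is) p , r ⟩∈ G
    moved zero    r = to-G ∘ subst (λ c → ⟨ c , r ⟩∈ F) (sym (θ-before (first<start o)))
    moved (suc p) r = to-G ∘ subst (λ c → ⟨ c , r ⟩∈ F)
      (sym (trans (cong θ (lookup-tail is p)) (extend-image e-injective (φ ⟨$⟩ʳ_) p)))

  -- Since `θ` fixes the block of the occurrence, only the first letter may sit in a different
  -- column of `F`; this is harmless while that column stays left of the block.
  occurrence-pullback : ∀ {α : Permutation′ (suc (suc k))} {is′ ρ′} →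
    IsOccurrence D G (dashedAfterFirst α) is′ ρ′ →
    (∀ p → θ (columnsOf is′ p) ≡ columnsOf is′ p) →
    toℕ (θ (lookup is′ zero)) < startColumn is′ →
    Occurs {D = D} F α (startColumn is′)
  occurrence-pullback {α} {is′} o′ fixed before = θ (lookup is′ zero) ∷ tail is′ , _ ,
    transport o′ {π′ = α} id (θ (lookup is′ zero)) before (λ _ → refl) moved , cong toℕ (lookup-tail is′ zero)
    where
    moved : ∀ p r → ⟨ lookup is′ p , r ⟩∈ G → ⟨ lookup (θ (lookup is′ zero) ∷ tail is′) p , r ⟩∈ F
    moved zero    r = to-F
    moved (suc p) r = subst (λ c → ⟨ c , r ⟩∈ F) (trans (fixed p) (sym (lookup-tail is′ p))) ∘ to-F

-- Exchanging the two patterns at a single starting column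

steps⇒constant : (g : ℕ → A) → (∀ t → g t ≡ g (suc t)) → ∀ t → g 0 ≡ g t
steps⇒constant g step zero    = refl
steps⇒constant g step (suc t) = trans (steps⇒constant g step t) (step t)

-- With the next lemma: passing from threshold t to t+1 changes the forbidden pattern at column t
-- alone, which is a single exchange.
<ᵇ-suc-at : ∀ t → (t <ᵇ suc t) ≡ not (t <ᵇ t)
<ᵇ-suc-at zero    = refl
<ᵇ-suc-at (suc t) = <ᵇ-suc-at t

<ᵇ-suc-away : ∀ t s → s ≢ t → (s <ᵇ t) ≡ (s <ᵇ suc t)
<ᵇ-suc-away zero    zero    s≢t = contradiction refl s≢t
<ᵇ-suc-away zero    (suc s) s≢t = refl
<ᵇ-suc-away (suc t) zero    s≢t = refl
<ᵇ-suc-away (suc t) (suc s) s≢t = <ᵇ-suc-away t s (s≢t ∘ cong suc)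

-- For the theorem, `lo` is i, `hi` is j, and `pat` lists σ and τ. Indexing by Booleans treats both
-- patterns alike, so that one construction serves in both directions.
module Exchange {k lo hi : ℕ} (hi<1+k : hi < suc k)
  (pat : Bool → Permutation′ (suc (suc k)))
  (agree : ∀ x y p → toℕ p ≤ lo ⊎ hi < toℕ p → pat x ⟨$⟩ʳ p ≡ pat y ⟨$⟩ʳ p)
  (bounded : ∀ x y {z} (z<k : z < suc k) → lo ⊓ (suc k ∸ hi) < z →
             ¬ (initialFactor z<k (word (pat x)) ∼ finalFactor z<k (word (pat y))))
  {n m : ℕ} (D : YoungDiagram n m) (R : Subset m) (C : Subset n) where

  overlap-bound : ∀ {F x y is ρ is′ ρ′} → IsFilling D F →
    IsOccurrence D F (dashedAfterFirst (pat x)) is ρ →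
    IsOccurrence D F (dashedAfterFirst (pat y)) is′ ρ′ →
    startColumn is < startColumn is′ → startColumn is + suc k ≤ startColumn is′ + lo ⊓ (suc k ∸ hi)
  overlap-bound {x = x} {y} {is} {is′ = is′} filling o o′ s<t = ≮⇒≥ λ t+d<s+k →
    let t≤s+k : t ≤ s + suc k
        t≤s+k = ≤-trans (m≤m+n t _) (<⇒≤ t+d<s+k)
        -- `z` is the number of columns shared by the blocks. Were the bound violated, `z` would lie
        -- in the range excluded by `bounded`; `z<k` holds because the starts differ.
        z = s + suc k ∸ t
        t+z≡s+k : t + z ≡ s + suc k
        t+z≡s+k = m+[n∸m]≡n t≤s+k
        z<k : z < suc k
        z<k = +-cancelˡ-< s z (suc k) (<-≤-trans (+-monoˡ-< z s<t) (≤-reflexive t+z≡s+k))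
        d<z : lo ⊓ (suc k ∸ hi) < z
        d<z = +-cancelˡ-< t _ z (<-≤-trans t+d<s+k (≤-reflexive (sym t+z≡s+k)))
        t≡ : t ≡ s + (suc k ∸ z)
        t≡ = trans (sym (m+n∸n≡m t z)) (trans (cong (_∸ z) t+z≡s+k) (+-∸-assoc s (<⇒≤ z<k)))
    in bounded y x z<k d<z (overlap⇒∼ filling o o′ z<k t≡)
    where
    s = startColumn is
    t = startColumn is′

  -- f t tells which of the two patterns is forbidden to occur with its block starting in column t.
  AvoidsAt : (ℕ → Bool) → Cells n m → Set
  AvoidsAt f F = ¬ ∃ λ is → ∃ λ ρ → IsOccurrence D F (dashedAfterFirst (pat (f (startColumn is)))) is ρ

  Admissible : (ℕ → Bool) → Pred (Cells n m) _
  Admissible f F = IsFilling D F × AvoidsAt f F × EmptyRows F R × EmptyColumns F C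

  admissible? : ∀ f → Decidable (Admissible f)
  admissible? f F =
    isFilling? D F
    ×-dec ¬? (anyVec? _ λ is → anyVec? _ λ ρ →
      isOccurrence? D F (dashedAfterFirst (pat (f (startColumn is)))) is ρ)
    ×-dec (Fin.all? λ r → (r ∈? R) ⇔? (Fin.all? λ c → ¬? (⟨ c , r ⟩∈? F)))
    ×-dec (Fin.all? λ c → (c ∈? C) ⇔? (Fin.all? λ r → ¬? (⟨ c , r ⟩∈? F)))

  #admissible : (ℕ → Bool) → ℕ
  #admissible f = length (filter (admissible? f) (allCells n m))

  occursAt? : ∀ F x t → Dec (Occurs {D = D} F (pat x) t)
  occursAt? F x t = anyVec? _ λ is → anyVec? _ λ ρ →
    isOccurrence? D F (dashedAfterFirst (pat x)) is ρ ×-dec (startColumn is ≟ t)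

  avoids⇒¬occurs : ∀ f {F x t} → AvoidsAt f F → x ≡ f t → ¬ Occurs {D = D} F (pat x) t
  avoids⇒¬occurs f avoids refl (is , ρ , o , refl) = avoids (is , ρ , o)

  module AtOccurrence {F : Cells n m} (filling : IsFilling D F) {x is ρ}
    (o : IsOccurrence D F (dashedAfterFirst (pat x)) is ρ) (y : Bool) where

    open Rearrangement filling o (pat y) (agree x y zero (inj₁ z≤n)) public

    private
      t = startColumn is

    -- Block position `p` carries the letter in pattern position p+1, so the bounds of `agree` shift
    -- by one.
    φ-fixed : ∀ p → toℕ p < lo ⊎ hi ≤ toℕ p → φ ⟨$⟩ʳ p ≡ p
    φ-fixed p outer = realign-fixed (pat x) (pat y) (agree x y zero (inj₁ z≤n))
      (agree x y (suc p) (Sum.map id s≤s outer))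

    θ-fixed : ∀ {c} → toℕ c < t + lo ⊎ t + hi ≤ toℕ c → θ c ≡ c
    θ-fixed {c} outer with image? {e = e} c
    ... | inj₂ c∉e = extend-fixed _ c∉e
    ... | inj₁ (p , refl) = trans (extend-image e-injective (φ ⟨$⟩ʳ_) p) (cong e (φ-fixed p
      (Sum.map (λ < → +-cancelˡ-< t _ lo (subst (_< t + lo) (block-column o p) <))
               (λ ≤ → +-cancelˡ-≤ t hi _ (subst (t + hi ≤_) (block-column o p) ≤)) outer)))

    -- A column sent to t+hi or beyond would share its image with that image itself, which `θ`
    -- fixes.
    θ-below : ∀ {c} → toℕ c < t + hi → toℕ (θ c) < t + hi
    θ-below {c} c<t+hi = ≰⇒> λ t+hi≤θc →
      <⇒≱ c<t+hi (subst (t + hi ≤_) (cong toℕ (θ-injective (θ-fixed (inj₂ t+hi≤θc)))) t+hi≤θc)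

    -- `G` has an occurrence of `pat y` starting at t, so `overlap-bound` applies within `G` and
    -- keeps the given block clear of the columns that `θ` moves.
    other-occurrence : ∀ {w s} → s ≢ t → Occurs {D = D} G (pat w) s → Occurs {D = D} F (pat w) s
    other-occurrence s≢t (is′ , ρ′ , o′ , refl) with G-occurrence | <-cmp (startColumn is′) t
    ... | _ | tri≈ _ s≡t _ = contradiction s≡t s≢t
    -- The given block ends before column t+lo and its first letter lies before t, so `θ` fixes the
    -- whole occurrence.
    ... | is″ , ρ″ , o″ , eq | tri< s<t _ _ = occurrence-pullback o′
      (λ p → θ-fixed (inj₁ (<-≤-trans
        (subst (_< s + suc k) (sym (block-column o′ p)) (+-monoʳ-< s (Fin.toℕ<n p))) bound)))
      (subst (λ c → toℕ c < s) (sym (θ-before (<-trans (first<start o′) s<t))) (first<start o′))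
      where
      s = startColumn is′
      bound : s + suc k ≤ t + lo
      bound = ≤-trans (overlap-bound G-filling o′ o″ (subst (s <_) (sym eq) s<t))
        (+-mono-≤ (≤-reflexive eq) (m⊓n≤m lo _))
    -- The given block starts at t+hi or later and is fixed; only its first letter may be moved.
    ... | is″ , ρ″ , o″ , eq | tri> _ _ t<s = occurrence-pullback o′
      (λ p → θ-fixed (inj₂ (≤-trans bound
        (≤-trans (m≤m+n s (toℕ p)) (≤-reflexive (sym (block-column o′ p)))))))
      first
      where
      s = startColumn is′
      bound : t + hi ≤ s
      bound = +-cancelʳ-≤ (suc k ∸ hi) _ _ (begin
        t + hi + (suc k ∸ hi)          ≡⟨ +-assoc t hi _ ⟩
        t + (hi + (suc k ∸ hi))        ≡⟨ cong₂ _+_ (sym eq) (m+[n∸m]≡n (<⇒≤ hi<1+k)) ⟩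
        startColumn is″ + suc k              ≤⟨ overlap-bound G-filling o″ o′ (subst (_< s) (sym eq) t<s) ⟩
        s + lo ⊓ (suc k ∸ hi)          ≤⟨ +-monoʳ-≤ s (m⊓n≤n lo _) ⟩
        s + (suc k ∸ hi)               ∎)
        where open ≤-Reasoning
      first : toℕ (θ (lookup is′ zero)) < s
      -- The first letter may lie among the rearranged columns, but `θ` keeps it below t+hi and so
      -- left of the block.
      first with toℕ (lookup is′ zero) <? t + hi
      ... | yes < = <-≤-trans (θ-below <) bound
      ... | no  ≮ = subst (λ c → toℕ c < s) (sym (θ-fixed (inj₂ (≮⇒≥ ≮)))) (first<start o′)

  -- The exchange as an injection

  module _ (f f′ : ℕ → Bool) (t : ℕ) (f′t≡ : f′ t ≡ not (f t)) (f≗f′ : ∀ s → s ≢ t → f s ≡ f′ s) where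

    -- The graph of the injection from the f-admissible to the f′-admissible fillings; the disjuncts record
    -- what makes the two cases distinguishable from G.
    Exchanged : Cells n m → Cells n m → Set
    Exchanged F G =
      (G ≡ F × AvoidsAt f F) ⊎
      (∃ λ is → ∃ λ ρ → IsOccurrence D F (dashedAfterFirst (pat (f′ t))) is ρ × startColumn is ≡ t ×
        G ≡ rearrange (columnsOf is) (realign (pat (f′ t)) (pat (f t))) F × IsFilling D F)

    -- Separates the two cases of `Exchanged`: after a rearrangement `pat (f t)` occurs at t, while
    -- a filling kept unchanged avoids it there.
    exchanged-occurs : ∀ {F G is ρ} → IsFilling D F →
      IsOccurrence D F (dashedAfterFirst (pat (f′ t))) is ρ → startColumn is ≡ t →
      G ≡ rearrange (columnsOf is) (realign (pat (f′ t)) (pat (f t))) F →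
      Occurs {D = D} G (pat (f t)) t
    exchanged-occurs filling o refl refl = AtOccurrence.G-occurrence filling o (f t)

    exchanged-injective : ∀ {F F′ G} → Exchanged F G → Exchanged F′ G → F ≡ F′
    exchanged-injective (inj₁ (refl , _)) (inj₁ (refl , _)) = refl
    exchanged-injective (inj₁ (refl , avoids)) (inj₂ (_ , _ , o , eq , G≡ , filling)) =
      contradiction (exchanged-occurs filling o eq G≡) (avoids⇒¬occurs f avoids refl)
    exchanged-injective (inj₂ (_ , _ , o , eq , G≡ , filling)) (inj₁ (refl , avoids)) =
      contradiction (exchanged-occurs filling o eq G≡) (avoids⇒¬occurs f avoids refl)
    exchanged-injective {F} {F′} (inj₂ (is , _ , o , refl , refl , filling))
                                 (inj₂ (is′ , _ , o′ , eq′ , G≡ , filling′)) = begin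
      F                    ≡⟨ tabulate∘lookup F ⟨
      tabulate (lookup F)  ≡⟨ tabulate-cong columns ⟩
      tabulate (lookup F′) ≡⟨ tabulate∘lookup F′ ⟩
      F′                   ∎
      where
      open ≡-Reasoning
      module E  = AtOccurrence filling o (f t)
      module E′ = AtOccurrence filling′ o′ (f t)
      -- Both blocks start at t and fill the same columns, so `E.θ` and `E′.θ` agree, and undoing
      -- them recovers one and the same filling.
      e≗e′ : ∀ p → columnsOf is p ≡ columnsOf is′ p
      e≗e′ p = Fin.toℕ-injective (trans (block-column o p)
        (trans (cong (_+ toℕ p) (sym eq′)) (sym (block-column o′ p))))
      columns : ∀ c → lookup F c ≡ lookup F′ c
      columns c = begin
        lookup F c                    ≡⟨ cong (lookup F) (E.θ∘θ⁻¹ c) ⟨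
        lookup F (E.θ (E.θ⁻¹ c))      ≡⟨ lookup∘tabulate (lookup F ∘ E.θ) _ ⟨
        lookup E.G (E.θ⁻¹ c)          ≡⟨ cong (λ G → lookup G (E.θ⁻¹ c)) G≡ ⟩
        lookup E′.G (E.θ⁻¹ c)         ≡⟨ lookup∘tabulate (lookup F′ ∘ E′.θ) _ ⟩
        lookup F′ (E′.θ (E.θ⁻¹ c))    ≡⟨ cong (lookup F′) (extend-cong E.e-injective e≗e′ _ _) ⟨
        lookup F′ (E.θ (E.θ⁻¹ c))     ≡⟨ cong (lookup F′) (E.θ∘θ⁻¹ c) ⟩
        lookup F′ c                   ∎

    -- If `pat (f′ t)` does not occur at t, the filling is kept; otherwise rearranging its block
    -- turns that occurrence into one of `pat (f t)`.
    exchange : ∀ {F} → Admissible f F → ∃ λ G → Admissible f′ G × Exchanged F G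
    exchange {F} (filling , avoids , rows , columns) with occursAt? F (f′ t) t
    ... | no ¬occurs = F , (filling , avoids′ , rows , columns) , inj₁ (refl , avoids)
      where
      avoids′ : AvoidsAt f′ F
      avoids′ (is , ρ , o) with startColumn is ≟ t
      ... | yes refl = ¬occurs (is , ρ , o , refl)
      ... | no  s≢t  = avoids⇒¬occurs f avoids (sym (f≗f′ _ s≢t)) (is , ρ , o , refl)
    ... | yes (is , ρ , o , refl) =
      G , (G-filling , avoids′ , G-emptyRows rows , G-emptyColumns columns) ,
      inj₂ (is , ρ , o , refl , refl , filling)
      where
      open AtOccurrence filling o (f t)
      avoids′ : AvoidsAt f′ G
      avoids′ (is′ , ρ′ , o′) with startColumn is′ ≟ t
      ... | no  s≢t = avoids⇒¬occurs f avoids (sym (f≗f′ _ s≢t)) (other-occurrence s≢t (is′ , ρ′ , o′ , refl))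
      -- Occurrences of `pat (f′ t)` and `pat (f t)` on one block make the patterns agree in all
      -- letters, so `F` would already contain `pat (f t)` at t.
      ... | yes s≡t with G-occurrence
      ...   | is″ , ρ″ , o″ , eq = avoids⇒¬occurs f avoids refl
        (occurs-cong o (pat (f t))
          (subst (λ s → ∀ p → pat (f′ s) ⟨$⟩ʳ p ≡ pat (f t) ⟨$⟩ʳ p) s≡t
            (same-start⇒≈ G-filling o′ o″ (trans s≡t (sym eq)) (agree _ _ zero (inj₁ z≤n)))))

    #admissible-≤ : #admissible f ≤ #admissible f′
    #admissible-≤ = length-mono-injective Exchanged exchanged-injective
      (Unique.filter⁺ (admissible? f) (allCells-unique n m))
      λ F∈ →
        let _ , F-admissible = ∈-filter⁻ (admissible? f) {xs = allCells n m} F∈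
            G , admissible , exchanged = exchange F-admissible
        in G , ∈-filter⁺ (admissible? f′) (allCells-complete G) admissible , exchanged

  -- The hypotheses are symmetric in `f` and `f′`, so there are injections in both directions.
  #admissible-exchange : ∀ f f′ t → f′ t ≡ not (f t) → (∀ s → s ≢ t → f s ≡ f′ s) →
                         #admissible f ≡ #admissible f′
  #admissible-exchange f f′ t f′t≡ f≗f′ = ≤-antisym
    (#admissible-≤ f f′ t f′t≡ f≗f′)
    (#admissible-≤ f′ f t (trans (sym (not-involutive (f t))) (cong not (sym f′t≡)))
      (λ s s≢t → sym (f≗f′ s s≢t)))

  -- Moving the threshold past all columns

  #admissible-threshold : ∀ t → #admissible (_<ᵇ 0) ≡ #admissible (_<ᵇ t)
  #admissible-threshold = steps⇒constant (λ t → #admissible (_<ᵇ t)) λ t →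
    #admissible-exchange (_<ᵇ t) (_<ᵇ suc t) t (<ᵇ-suc-at t) (<ᵇ-suc-away t)

  -- A block starts in one of the n columns, so only values of `f` below n matter.
  #admissible-constant : ∀ f x → (∀ {s} → s < n → f s ≡ x) →
    #admissible f ≡ #avoidingFillings D R C (dashedAfterFirst (pat x))
  #admissible-constant f x f≗x = cong length
    (filter-≐ (admissible? f) (avoidingFilling? D R C (dashedAfterFirst (pat x)))
      ( (λ { (filling , avoids , rest) → filling ,
             (λ { (is , ρ , o) → avoids (is , ρ , subst (Occ is ρ) (sym (f≗x (Fin.toℕ<n _))) o) }) , rest })
      , (λ { (filling , avoids , rest) → filling ,
             (λ { (is , ρ , o) → avoids (is , ρ , subst (Occ is ρ) (f≗x (Fin.toℕ<n _)) o) }) , rest }))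
      (allCells n m))
    where
    Occ : ∀ {F} → Vec (Fin n) (suc (suc k)) → Vec (Fin m) (suc (suc k)) → Bool → Set
    Occ {F} is ρ x = IsOccurrence D F (dashedAfterFirst (pat x)) is ρ

  #avoidingFillings-exchange : ∀ {P Q} → pat false ≡ P → pat true ≡ Q →
    #avoidingFillings D R C (dashedAfterFirst P) ≡ #avoidingFillings D R C (dashedAfterFirst Q)
  #avoidingFillings-exchange refl refl = begin
    #avoidingFillings D R C (dashedAfterFirst (pat false)) ≡⟨ #admissible-constant (_<ᵇ 0) false (λ _ → refl) ⟨
    #admissible (_<ᵇ 0)                                         ≡⟨ #admissible-threshold n ⟩
    #admissible (_<ᵇ n)                                         ≡⟨ #admissible-constant (_<ᵇ n) true below ⟩
    #avoidingFillings D R C (dashedAfterFirst (pat true))  ∎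
    where
    open ≡-Reasoning
    below : ∀ {s} → s < n → (s <ᵇ n) ≡ true
    below s<n = Equivalence.to T-≡ (<⇒<ᵇ s<n)

-- Specialization to σ and τ

theorem3p8 : ∀ (i j k : ℕ) (1≤i : 1 ≤ i) (i<j : i < j) (j<k : j < k)
    (σ τ : Permutation′ (suc k)) →
    middleFactor i<j j<k (word τ) ↭ middleFactor i<j j<k (word σ) →
    (∀ x → suc (toℕ x) ≤ i + 1 ⊎ j + 2 ≤ suc (toℕ x) → word τ x ≡ word σ x) →
    (∀ z (z<k : z < k) → i ⊓ (k ∸ j) < z →
    ¬ (initialFactor z<k (word σ) ∼ finalFactor z<k (word σ)) ×
    ¬ (initialFactor z<k (word σ) ∼ finalFactor z<k (word τ)) ×
    ¬ (initialFactor z<k (word τ) ∼ finalFactor z<k (word σ)) ×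
    ¬ (initialFactor z<k (word τ) ∼ finalFactor z<k (word τ))) →
    dashedAfterFirst σ ≡fs dashedAfterFirst τ
theorem3p8 i j (suc k) 1≤i i<j j<k σ τ _ σ≗τ bounded {n} {m} D R C =
  Exchange.#avoidingFillings-exchange j<k pat agree bounded′ D R C refl refl
  where
  pat : Bool → Permutation′ (suc (suc k))
  pat false = σ
  pat true  = τ

  -- The hypothesis counts positions from one and `toℕ` from zero; the successors account for the
  -- shift.
  letter : ∀ p → toℕ p ≤ i ⊎ j < toℕ p → τ ⟨$⟩ʳ p ≡ σ ⟨$⟩ʳ p
  letter p outer = Fin.toℕ-injective (suc-injective (σ≗τ p
    (Sum.map (subst (suc (toℕ p) ≤_) (+-comm 1 i) ∘ s≤s)
             (subst (_≤ suc (toℕ p)) (+-comm 2 j) ∘ s≤s) outer)))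

  agree : ∀ x y p → toℕ p ≤ i ⊎ j < toℕ p → pat x ⟨$⟩ʳ p ≡ pat y ⟨$⟩ʳ p
  agree false false p _     = refl
  agree false true  p outer = sym (letter p outer)
  agree true  false p outer = letter p outer
  agree true  true  p _     = refl

  bounded′ : ∀ x y {z} (z<k : z < suc k) → i ⊓ (suc k ∸ j) < z →
             ¬ (initialFactor z<k (word (pat x)) ∼ finalFactor z<k (word (pat y)))
  bounded′ x y {z} z<k d<z with bounded z z<k d<z
  bounded′ false false z<k d<z | σσ , _ , _ , _ = σσ
  bounded′ false true  z<k d<z | _ , στ , _ , _ = στ
  bounded′ true  false z<k d<z | _ , _ , τσ , _ = τσ
  bounded′ true  true  z<k d<z | _ , _ , _ , ττ = ττ
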